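{- For $s$ transforms of length $n=b^\ell$, the local PACO scheduler (defined in the context) performs $$W_{\mathrm{local}}(n,s)=O\bigl(ns(1+\log n)\bigr)$$ local work and uses $O(\log(ns))$ recursion-stack words. Under the tall-cache assumption $M=\Omega(B^2)$, and for an initial contiguous batch width at least $B$, it incurs $$Q_{\mathrm{local}}(n,s)=O\!\left(\frac{ns}{B}\bigl(1+\log_M n\bigr)\right)$$ cache misses.
   Context: $b=2^t=O(1)$ is a fixed radix. The machine is a sequential processor with a fully associative ideal cache of $M\ge2$ items, block size $B$, and optimal replacement; one complex scalar is one item. Evaluating one twiddle factor costs $O(1)$ work and no memory traffic. $\omega_n=\exp(2\pi\imath/n)$; $\pi_\ell$ is base-$b$ digit reversal on $\ell$-digit strings; $U\mathbin{+\!\!+}V$ denotes concatenation of digit fields ($U$ more significant). **Views.** The data are stored in a local array whose physical addresses are base-$b$ digit strings (slot $j$ has stride $b^j$, slot $0$ least significant). A recursive view partitions the digit slots into: active transform digits $T$, active outer-batch digits $O$, the distinguished contiguous batch digits $C$ (occupying exactly the slots $0,\dots,|C|-1$, so that varying this field traverses a contiguous memory run of length $c=b^{|C|}$, the contiguous width), and fixed digits, each with a fixed value. The view represents $s=b^{|O|+|C|}$ transforms of length $n=b^{|T|}$. The root view has parameters $(n,s)$, and its contiguous width is the initial contiguous batch width. **Scheduler** (it does not know $M$ or $B$; executed depth first). On a view with parameters $(n,s)$: 1. If $n\le b$ and $s\le b$: apply constant-size natural-order DFT kernels and return. 2. Else if $s\ge n$ (batch split): choose a digit of $O$ if $O\ne\emptyset$,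 otherwise the most significant active digit of $C$; recurse successively on the $b$ views obtained by fixing that digit to each value in $\{0,\dots,b-1\}$. 3. Else ($s<n$, transform split): with $\ell=|T|$ write $T=T_1\mathbin{+\!\!+}T_2$, $\ell_1=|T_1|=\lceil \ell/2\rceil$, $\ell_2=|T_2|=\lfloor \ell/2\rfloor$, $n_i=b^{\ell_i}$. First recurse on the view with transform digits $T_1$, outer-batch digits $T_2\mathbin{+\!\!+}O$, and the same $C$ (parameters $(n_1,sn_2)$). Then recurse on the view with transform digits $T_2$, outer-batch digits $T_1\mathbin{+\!\!+}O$ (the slots of $T_1$, now holding first-stage outputs), and the same $C$ (parameters $(n_2,sn_1)$); when the second group first accesses the item with $T_1$-coordinate $a$ and $T_2$-coordinate $j_2$, that item is multiplied by the twiddle $\omega_n^{ -k_1j_2}$, where $k_1=\pi_{\ell_1}(a)$ is the logical frequency it represents. No split moves data. (In input-layout mode the recursion is the same with physical transform coordinates read through digit reversal.) -}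

module Defs where

open import Data.Nat
open import Data.Nat.Properties
open import Data.Nat.Induction using (<-wellFounded)
open import Data.Fin using (Fin; toℕ; zero)
open import Data.List using (List; []; _∷_; _++_; map; concat; tabulate; sum;
  foldr; take; drop; length; lookup; removeAt; downFrom)
open import Data.List.Properties using (length-++; length-take; length-drop; length-removeAt)
open import Data.List.NonEmpty as List⁺ using (List⁺; _∷⁺_)
open import Data.List.Membership.DecPropositional _≟_ using (_∈?_)
open import Data.List.Relation.Binary.Permutation.Propositional using (_↭_)
open import Data.Product using (_×_; _,_; proj₁; proj₂)
open import Data.Vec using (Vec; []; _∷_)
open import Induction.WellFounded using (Acc; acc)
open import Relation.Binary.PropositionalEquality
open import Relation.Nullary using (¬_; yes; no; contradiction)
open import Relation.Nullary.Decidable using (_×-dec_)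

-- Slots are natural numbers, slot j having stride b ^ j.  Every digit field
-- lists its slots from the most to the least significant digit, so _++_ is
-- concatenation of digit fields.

record View (b : ℕ) : Set where
  constructor view
  field
    transform : List ℕ
    outer     : List ℕ
    contig    : List ℕ
    fixed     : List (ℕ × Fin b)

  size : ℕ
  size = b ^ length transform

  batch : ℕ
  batch = b ^ (length outer + length contig)

  width : ℕ
  width = b ^ length contig

open View public

record IsView {b : ℕ} (L : ℕ) (v : View b) : Set where
  field
    partition  : transform v ++ outer v ++ contig v ++ map proj₁ (fixed v) ↭ downFrom L
    contiguous : contig v ≡ downFrom (length (contig v))

module _ {b : ℕ} where

  fixOuter : (v : View b) → Fin (length (outer v)) → Fin b → View b
  fixOuter (view T O C F) i d = view T (removeAt O i) C ((lookup O i , d) ∷ F)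

  fixContig : View b → ℕ → List ℕ → Fin b → View b
  fixContig (view T O _ F) j C′ d = view T O C′ ((j , d) ∷ F)

  T₁ T₂ : View b → List ℕ
  T₁ v = take ⌈ length (transform v) /2⌉ (transform v)
  T₂ v = drop ⌈ length (transform v) /2⌉ (transform v)

  first second : View b → View b
  first  v = view (T₁ v) (T₂ v ++ outer v) (contig v) (fixed v)
  second v = view (T₂ v) (T₁ v ++ outer v) (contig v) (fixed v)

  Base : View b → Set
  Base v = size v ≤ b × batch v ≤ b

  -- The complete executions of the scheduler on a view.  An execution records
  -- the choice of outer digit made at each batch split: the scheduler leaves
  -- that choice open.

  data Exec (v : View b) : Set where
    kernel      : Base v → Exec v
    splitOuter  : ¬ Base v → size v ≤ batch v →
                  (i : Fin (length (outer v))) →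
                  ((d : Fin b) → Exec (fixOuter v i d)) → Exec v
    splitContig : ¬ Base v → size v ≤ batch v → outer v ≡ [] →
                  ∀ j C′ → contig v ≡ j ∷ C′ →
                  ((d : Fin b) → Exec (fixContig v j C′ d)) → Exec v
    splitTransform : ¬ Base v → batch v < size v →
                     Exec (first v) → Exec (second v) → Exec v

-- The constants hidden in "constant-size kernel" and "O(1)".  A kernel call is
-- given by the items it reads and writes, in order, an item being named by its
-- transform, outer and contiguous digits; kernels are only called on views with
-- size and batch at most b, so these lists have bounded length.

record Implementation (b : ℕ) : Set where
  field
    kernelAccesses : ∀ τ o c → List (Vec (Fin b) τ × Vec (Fin b) o × Vec (Fin b) c)
    kernelWork     : (n s : ℕ) → ℕ
    twiddleWork    : ℕ
    callWork       : ℕ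
    frameWords     : ℕ

module _ {b : ℕ} where

  offset : (js : List ℕ) → Vec (Fin b) (length js) → ℕ
  offset []       []       = 0
  offset (j ∷ js) (d ∷ ds) = toℕ d * b ^ j + offset js ds

  fixedOffset : List (ℕ × Fin b) → ℕ
  fixedOffset F = sum (map (λ (j , d) → toℕ d * b ^ j) F)

  address : (v : View b) → Vec (Fin b) (length (transform v)) ×
            Vec (Fin b) (length (outer v)) × Vec (Fin b) (length (contig v)) → ℕ
  address (view T O C F) (x , y , z) =
    offset T x + offset O y + offset C z + fixedOffset F

module _ {b : ℕ} (I : Implementation b) where
  open Implementation I

  -- The physical addresses accessed, in order.  Twiddle factors are applied
  -- during accesses that the second group makes anyway, so they add none.

  trace : {v : View b} → Exec v → List ℕ
  trace {v} (kernel _)              = map (address v) (kernelAccesses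
    (length (transform v)) (length (outer v)) (length (contig v)))
  trace (splitOuter _ _ _ es)       = concat (tabulate λ d → trace (es d))
  trace (splitContig _ _ _ _ _ _ es) = concat (tabulate λ d → trace (es d))
  trace (splitTransform _ _ e₁ e₂)  = trace e₁ ++ trace e₂

  -- At a transform split, each of the size * batch items is multiplied by one
  -- twiddle factor.

  work : {v : View b} → Exec v → ℕ
  work {v} (kernel _)               = callWork + kernelWork (size v) (batch v)
  work (splitOuter _ _ _ es)        = callWork + sum (tabulate λ d → work (es d))
  work (splitContig _ _ _ _ _ _ es) = callWork + sum (tabulate λ d → work (es d))
  work {v} (splitTransform _ _ e₁ e₂) =
    callWork + work e₁ + work e₂ + twiddleWork * (size v * batch v)

  stackWords : {v : View b} → Exec v → ℕ
  stackWords (kernel _)                   = frameWords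
  stackWords (splitOuter _ _ _ es)        =
    frameWords + foldr _⊔_ 0 (tabulate λ d → stackWords (es d))
  stackWords (splitContig _ _ _ _ _ _ es) =
    frameWords + foldr _⊔_ 0 (tabulate λ d → stackWords (es d))
  stackWords (splitTransform _ _ e₁ e₂)   =
    frameWords + (stackWords e₁ ⊔ stackWords e₂)

-- Ideal cache: the state is the list of resident blocks, and the second
-- argument of optimalMisses is a sequence of requested blocks.

evictOne : ℕ → List ℕ → List⁺ (List ℕ)
evictOne y []       = List⁺.[ [] ]
evictOne y (z ∷ zs) = (z ∷ zs) ∷⁺ List⁺.map (y ∷_) (evictOne z zs)

-- The possible states after a miss on x.  A cache without any line (M < B)
-- retains nothing, so that every access misses.

afterMiss : (lines x : ℕ) → List ℕ → List⁺ (List ℕ)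
afterMiss zero    x C = List⁺.[ [] ]
afterMiss (suc k) x [] = List⁺.[ x ∷ [] ]
afterMiss (suc k) x C@(y ∷ ys) with length C ≤? k
... | yes _ = List⁺.[ x ∷ C ]
... | no  _ = List⁺.map (x ∷_) (evictOne y ys)

optimalMisses : (lines : ℕ) → List ℕ → List ℕ → ℕ
optimalMisses k C []       = 0
optimalMisses k C (x ∷ xs) with x ∈? C
... | yes _ = optimalMisses k C xs
... | no  _ = suc (List⁺.foldr₁ _⊓_
                (List⁺.map (λ C′ → optimalMisses k C′ xs) (afterMiss k x C)))

cacheMisses : {b : ℕ} → Implementation b → (M B : ℕ) .{{_ : NonZero B}} →
              {v : View b} → Exec v → ℕ
cacheMisses I M B e = optimalMisses (M / B) [] (map (_/ B) (trace I e))

-- x ≤ y · (1 + log_M n) in the reals, for 2 ≤ M and 1 ≤ n, that is,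
-- (x - y) · log M ≤ y · log n, exponentiated; it holds trivially if x ≤ y.

infix 4 _≤_·⟨1+log[_]_⟩

_≤_·⟨1+log[_]_⟩ : (x y M n : ℕ) → Set
x ≤ y ·⟨1+log[ M ] n ⟩ = M ^ (x ∸ y) ≤ n ^ y

-- The scheduler terminates on every view, whatever it has to choose from.

module _ {b : ℕ} .{{_ : NonZero b}} where

  private
    measure : View b → ℕ
    measure (view T O C _) = length T + (length T + (length O + length C))

    ^≤b : ∀ {k} → k ≤ 1 → b ^ k ≤ b
    ^≤b {k} k≤1 = subst (b ^ k ≤_) (^-identityʳ b) (^-monoʳ-≤ b k≤1)

    shorter : ∀ t u o c → 0 < u → t + (t + ((u + o) + c)) < (t + u) + ((t + u) + (o + c))
    shorter t u o c 0<u = subst₂ _<_ (+-identityʳ _) eq (+-monoʳ-< (t + (t + ((u + o) + c))) 0<u)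
      where
      open ≡-Reasoning
      eq : (t + (t + ((u + o) + c))) + u ≡ (t + u) + ((t + u) + (o + c))
      eq = begin
        (t + (t + ((u + o) + c))) + u   ≡⟨ +-assoc t _ u ⟩
        t + ((t + ((u + o) + c)) + u)   ≡⟨ cong (t +_) (+-comm _ u) ⟩
        t + (u + (t + ((u + o) + c)))   ≡⟨ +-assoc t u _ ⟨
        (t + u) + (t + ((u + o) + c))   ≡⟨ cong (λ z → (t + u) + (t + z)) (+-assoc u o c) ⟩
        (t + u) + (t + (u + (o + c)))   ≡⟨ cong ((t + u) +_) (+-assoc t u _) ⟨
        (t + u) + ((t + u) + (o + c))   ∎

    run : (v : View b) → Acc _<_ (measure v) → Exec v
    run v a with (size v ≤? b) ×-dec (batch v ≤? b) | size v ≤? batch v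
    run v a | yes base | _ = kernel base
    run (view T (j ∷ O) C F) (acc rs) | no ¬base | yes n≤s =
      splitOuter ¬base n≤s zero λ d → run _ (rs (+-monoʳ-< (length T) (+-monoʳ-< (length T) ≤-refl)))
    run (view T [] (j ∷ C) F) (acc rs) | no ¬base | yes n≤s =
      splitContig ¬base n≤s refl j C refl λ d →
        run _ (rs (+-monoʳ-< (length T) (+-monoʳ-< (length T) ≤-refl)))
    run (view T [] [] F) a | no ¬base | yes n≤s =
      contradiction (≤-trans n≤s (^≤b z≤n) , ^≤b z≤n) ¬base
    run v@(view T O C F) (acc rs) | no ¬base | no n≰s =
      splitTransform ¬base s<n (run _ (rs fst<)) (run _ (rs snd<))
      where
      s<n = ≰⇒> n≰s
      ℓ = length T
      2≤ℓ : 2 ≤ ℓ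
      2≤ℓ = ≰⇒> λ ℓ≤1 → ¬base (^≤b ℓ≤1 , ≤-trans (<⇒≤ s<n) (^≤b ℓ≤1))
      ℓ₁≡ : length (T₁ v) ≡ ⌈ ℓ /2⌉
      ℓ₁≡ = trans (length-take ⌈ ℓ /2⌉ T) (m≤n⇒m⊓n≡m (⌈n/2⌉≤n ℓ))
      ℓ₂≡ : length (T₂ v) ≡ ⌊ ℓ /2⌋
      ℓ₂≡ = trans (length-drop ⌈ ℓ /2⌉ T)
        (trans (cong (_∸ ⌈ ℓ /2⌉) (sym (⌊n/2⌋+⌈n/2⌉≡n ℓ))) (m+n∸n≡m ⌊ ℓ /2⌋ ⌈ ℓ /2⌉))
      0<ℓ₂ : 0 < length (T₂ v)
      0<ℓ₂ = subst (0 <_) (sym ℓ₂≡) (⌊n/2⌋-mono 2≤ℓ)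
      0<ℓ₁ : 0 < length (T₁ v)
      0<ℓ₁ = subst (0 <_) (sym ℓ₁≡) (⌈n/2⌉-mono (<⇒≤ 2≤ℓ))
      ℓ₂+ℓ₁≡ℓ : length (T₂ v) + length (T₁ v) ≡ ℓ
      ℓ₂+ℓ₁≡ℓ = trans (cong₂ _+_ ℓ₂≡ ℓ₁≡) (⌊n/2⌋+⌈n/2⌉≡n ℓ)
      ℓ₁+ℓ₂≡ℓ : length (T₁ v) + length (T₂ v) ≡ ℓ
      ℓ₁+ℓ₂≡ℓ = trans (+-comm (length (T₁ v)) _) ℓ₂+ℓ₁≡ℓ
      smaller : ∀ X Y → length X + length Y ≡ ℓ → 0 < length Y →
                measure (view X (Y ++ O) C F) < measure v
      smaller X Y eq 0<Y = subst₂ _<_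
        (cong (λ z → length X + (length X + (z + length C))) (sym (length-++ Y)))
        (cong (λ z → z + (z + (length O + length C))) eq)
        (shorter (length X) (length Y) (length O) (length C) 0<Y)
      fst< : measure (first v) < measure v
      fst< = smaller (T₁ v) (T₂ v) ℓ₁+ℓ₂≡ℓ 0<ℓ₂
      snd< : measure (second v) < measure v
      snd< = smaller (T₂ v) (T₁ v) ℓ₂+ℓ₁≡ℓ 0<ℓ₁

  execution : (v : View b) → Exec v
  execution v = run v (<-wellFounded (measure v))

{-# OPTIONS --safe #-}
module Submission where

-- Write b for the radix, n = b ^ ℓ and s for the parameters of a view, N = n s for
-- its number of items and c for its contiguous width.
--
-- Work.  Every batch split has b ≥ 2 parts and every transform split replaces ℓ ≥ 2
-- by two positive halves of sum ℓ at constant cost per item.  Induction gives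
-- O (N (1 ⊔ ℓ)), once the claim is strengthened by a slack that pays for the cost of
-- the calls themselves (cost+slack-≤).  The length of the trace obeys the same
-- recurrence.
--
-- Stack.  Each call decreases ℓ + log_b N, so the depth is O (1 + log_b N).
--
-- Misses.  Two facts about the ideal cache suffice.  Requests confined to a set of
-- blocks that fits in the cache cost at most one miss per block of the set, from any
-- initial state (optimalMisses-⊆), and the misses of consecutive phases add up
-- (optimalMisses-++).  The recursion is cut at the first views with E N ≤ M, for a
-- large constant E.  If the width of such a view is at least B / H, for a second
-- constant H, then its runs meet O (N / B) blocks and these fit in the cache.  The
-- width never falls below B / H before that: the contiguous digits are split only
-- when no outer digit is left and n ≤ s = c, so N ≤ c * c, and if c is about B / H
-- then the tall cache assumption makes N small enough (width-fixContig).  A view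
-- that has not been cut and has s < n satisfies M < E N ≤ E n n, so both halves of its
-- transform digits have length at least some μ proportional to log_b M.  Therefore
-- the cut recursion meets every item at most 1 ⊔ ℓ / μ = O (1 + log_M n) times, and B
-- times the number of misses is at most E N (1 ⊔ ℓ / μ) (misses-≤).  For M below a
-- constant, B is bounded as well, and the length of the trace is a sufficient bound.

open import Defs
open import Data.Nat
open import Data.Nat.DivMod using (m≡m%n+[m/n]*n; m%n<n; m/n*n≤m; /-monoˡ-≤; m*n/n≡m; m<n*o⇒m/o<n)
open import Data.Nat.ListAction using (sum)
open import Data.Nat.Logarithm using (⌊log₂_⌋; ⌊log₂[2^n]⌋≡n)
open import Data.Nat.Properties
open import Data.Nat.Tactic.RingSolver using (solve-∀)
open import Data.Fin using (Fin; zero; suc; toℕ; fromℕ<)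
open import Data.Fin.Properties using (toℕ<n)
open import Data.List using (List; []; _∷_; [_]; _++_; map; length; concat; tabulate; foldr;
  drop; downFrom; upTo; allFin; cartesianProductWith; removeAt; lookup)
open import Data.List.Membership.DecPropositional _≟_ using (_∈?_)
open import Data.List.Membership.Propositional using (_∈_; _∉_; find)
open import Data.List.Membership.Propositional.Properties
  using (∈-map⁺; ∈-map⁻; ∈-++⁺ˡ; ∈-++⁺ʳ; ∈-++⁻; ∈-∃++; ∈-cartesianProductWith⁺; ∈-allFin; ∈-upTo⁺)
open import Data.List.NonEmpty as List⁺ using (List⁺; toList)
open import Data.List.Properties using (length-++; length-++-sucʳ; length-map; length-take;
  length-drop; length-removeAt′; length-upTo; length-tabulate; map-++; take++drop≡id; ++-assoc)
open import Data.List.Relation.Binary.Permutation.Propositional as ↭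
  using (_↭_; prep; swap; ↭-sym; ↭-reflexive; ↭-trans)
import Data.List.Relation.Binary.Permutation.Propositional.Properties as ↭
open import Data.List.Relation.Binary.Sublist.Propositional as Sublist
  using ([]; _∷_; _∷ʳ_) renaming (_⊆_ to _⊑_)
open import Data.List.Relation.Binary.Sublist.Propositional.Properties using (All-resp-⊆)
open import Data.List.Relation.Binary.Subset.Propositional using (_⊆_)
open import Data.List.Relation.Unary.All as All using (All; []; _∷_)
import Data.List.Relation.Unary.All.Properties as All
open import Data.List.Relation.Unary.All.Properties using (¬All⇒Any¬; ¬Any⇒All¬)
open import Data.List.Relation.Unary.AllPairs using ([]; _∷_)
open import Data.List.Relation.Unary.Any using (here; there)
open import Data.List.Relation.Unary.Unique.Propositional using (Unique)
open import Data.Product using (∃-syntax; _×_; _,_; proj₁; proj₂)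
open import Data.Sum using (_⊎_; inj₁; inj₂; [_,_]′)
open import Data.Vec using (Vec; []; _∷_)
open import Function using (_∘_; it)
open import Relation.Binary.PropositionalEquality hiding ([_])
open import Relation.Nullary using (¬_; yes; no; contradiction)

-- The ideal cache

private variable
  A : Set

-- The least value of f on a nonempty list.  With the list afterMiss k x C this
-- is the choice made by the optimal replacement policy.

minOver : (A → ℕ) → List⁺ A → ℕ
minOver f xs = List⁺.foldr₁ _⊓_ (List⁺.map f xs)

minOver-≤ : (f : A → ℕ) (xs : List⁺ A) {x : A} → x ∈ toList xs → minOver f xs ≤ f x
minOver-≤ f (x List⁺.∷ [])     (here refl) = ≤-refl
minOver-≤ f (x List⁺.∷ y ∷ xs) (here refl) = m⊓n≤m (f x) _
minOver-≤ f (x List⁺.∷ y ∷ xs) (there i)   =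
  ≤-trans (m⊓n≤n (f x) _) (minOver-≤ f (y List⁺.∷ xs) i)

minOver-attained : (f : A → ℕ) (xs : List⁺ A) →
  ∃[ x ] x ∈ toList xs × minOver f xs ≡ f x
minOver-attained {A} f (x List⁺.∷ xs) = go x xs
  where
  go : ∀ x (xs : List A) → ∃[ z ] z ∈ x ∷ xs × minOver f (x List⁺.∷ xs) ≡ f z
  go x []       = x , here refl , refl
  go x (y ∷ xs) with go y xs | ⊓-sel (f x) (minOver f (y List⁺.∷ xs))
  ... | _            | inj₁ eq = x , here refl , eq
  ... | z , i , eq′  | inj₂ eq = z , there i , trans eq eq′

unique-⊆⇒length-≤ : {xs ys : List ℕ} → Unique xs → xs ⊆ ys → length xs ≤ length ys
unique-⊆⇒length-≤ []         _     = z≤n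
unique-⊆⇒length-≤ {x ∷ xs} {ys} (x≢ ∷ u) xs⊆ys
  with as , bs , refl ← ∈-∃++ (xs⊆ys (here refl)) =
  subst (suc (length xs) ≤_) (sym (length-++-sucʳ as x bs))
    (s≤s (unique-⊆⇒length-≤ u λ i → delete (λ where refl → All.lookup x≢ i refl) (∈-++⁻ as (xs⊆ys (there i)))))
  where
  delete : ∀ {z} → z ≢ x → z ∈ as ⊎ z ∈ x ∷ bs → z ∈ as ++ bs
  delete z≢x (inj₁ i)           = ∈-++⁺ˡ i
  delete z≢x (inj₂ (here refl)) = contradiction refl z≢x
  delete z≢x (inj₂ (there i))   = ∈-++⁺ʳ as i

evictOne-⊑ : ∀ y ys {C} → C ∈ toList (evictOne y ys) → C ⊑ y ∷ ys
evictOne-⊑ y []       (here refl) = y ∷ʳ []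
evictOne-⊑ y (z ∷ zs) (here refl) = y ∷ʳ Sublist.⊆-refl
evictOne-⊑ y (z ∷ zs) (there i) with ∈-map⁻ (y ∷_) i
... | C , j , refl = refl ∷ evictOne-⊑ z zs j

unique-⊑ : {xs ys : List ℕ} → xs ⊑ ys → Unique ys → Unique xs
unique-⊑ []         u        = u
unique-⊑ (y ∷ʳ s)   (_ ∷ u)  = unique-⊑ s u
unique-⊑ (refl ∷ s) (y≢ ∷ u) = All-resp-⊆ s y≢ ∷ unique-⊑ s u

afterMiss-unique : ∀ k {x C C′} → x ∉ C → Unique C →
  C′ ∈ toList (afterMiss k x C) → Unique C′
afterMiss-unique zero    x∉C u (here refl) = []
afterMiss-unique (suc k) {C = []} x∉C u (here refl) = [] ∷ []
afterMiss-unique (suc k) {C = C@(y ∷ ys)} x∉C u i with length C ≤? k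
afterMiss-unique (suc k) {C = C@(y ∷ ys)} x∉C u (here refl) | yes _ = ¬Any⇒All¬ _ x∉C ∷ u
afterMiss-unique (suc k) {x} {C = C@(y ∷ ys)} x∉C u i | no _
  with C″ , j , refl ← ∈-map⁻ (x ∷_) i =
  unique-⊑ (refl ∷ evictOne-⊑ y ys j) (¬Any⇒All¬ _ x∉C ∷ u)

-- Any given resident block can be evicted without losing another one.

evictOne-drop : ∀ y ys {z} → z ∈ y ∷ ys →
  ∃[ C ] C ∈ toList (evictOne y ys) × (∀ {s} → s ∈ y ∷ ys → s ≢ z → s ∈ C)
evictOne-drop y []       (here refl) =
  [] , here refl , λ { (here s≡z) s≢z → contradiction s≡z s≢z }
evictOne-drop y (z ∷ zs) (here refl) = z ∷ zs , here refl ,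
  λ { (here s≡z) s≢z → contradiction s≡z s≢z ; (there i) _ → i }
evictOne-drop y (z ∷ zs) (there i) with C , j , keep ← evictOne-drop z zs i =
  y ∷ C , there (∈-map⁺ (y ∷_) j) ,
  λ { (here eq) _ → here eq ; (there k) s≢ → there (keep k s≢) }

-- A working set S that fits in the cache never loses a resident element to a
-- miss inside S: if the cache is full, the pigeonhole principle leaves a
-- resident block outside S, and that one can be evicted.

afterMiss-keeps : ∀ k {x C} S → x ∈ S → length S ≤ k → x ∉ C → Unique C →
  ∃[ C′ ] C′ ∈ toList (afterMiss k x C) × x ∈ C′ × (∀ {s} → s ∈ S → s ∈ C → s ∈ C′)
afterMiss-keeps zero    (_ ∷ _) _ () x∉C u
afterMiss-keeps (suc k) {C = []} S x∈S S≤k x∉C u = _ , here refl , here refl , λ _ ()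
afterMiss-keeps (suc k) {x} {C = C@(y ∷ ys)} S x∈S S≤k x∉C u with length C ≤? k
... | yes _   = _ , here refl , here refl , λ _ → there
... | no C≰k with All.all? (_∈? S) C
...   | yes C⊆S = contradiction (≤-pred (≤-trans
          (unique-⊆⇒length-≤ (¬Any⇒All¬ _ x∉C ∷ u) (All.lookup (x∈S ∷ C⊆S))) S≤k)) C≰k
...   | no C⊈S =
  let z , z∈C , z∉S = find (¬All⇒Any¬ (_∈? S) C C⊈S)
      C′ , i , keep = evictOne-drop y ys z∈C
  in x ∷ C′ , ∈-map⁺ (x ∷_) i , here refl ,
     λ s∈S s∈C → there (keep s∈C λ { refl → z∉S s∈S })

-- Requests within a working set S of at most k blocks cost at most one miss for
-- each element of S that is not yet resident.  The list R covers these elements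
-- and loses one at each miss.

optimalMisses-⊆ : ∀ k S → length S ≤ k → ∀ {C} R → Unique C →
  (∀ {s} → s ∈ S → s ∈ C ⊎ s ∈ R) → ∀ {xs} → xs ⊆ S → optimalMisses k C xs ≤ length R
optimalMisses-⊆ k S S≤k R u cover {[]}     xs⊆S = z≤n
optimalMisses-⊆ k S S≤k {C} R u cover {x ∷ xs} xs⊆S with x ∈? C
... | yes _  = optimalMisses-⊆ k S S≤k R u cover (xs⊆S ∘ there)
... | no x∉C with cover (xs⊆S (here refl))
...   | inj₁ x∈C = contradiction x∈C x∉C
...   | inj₂ x∈R
  with as , bs , refl ← ∈-∃++ x∈R
     | C′ , i , x∈C′ , keep ← afterMiss-keeps k S (xs⊆S (here refl)) S≤k x∉C u =
  subst (suc (minOver (λ C′ → optimalMisses k C′ xs) (afterMiss k x C)) ≤_)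
    (sym (length-++-sucʳ as x bs))
    (s≤s (≤-trans (minOver-≤ _ (afterMiss k x C) i)
      (optimalMisses-⊆ k S S≤k (as ++ bs) (afterMiss-unique k x∉C u i) cover′ (xs⊆S ∘ there))))
  where
  loaded : ∀ {s} → s ∈ as ⊎ s ∈ x ∷ bs → s ∈ C′ ⊎ s ∈ as ++ bs
  loaded (inj₁ j)           = inj₂ (∈-++⁺ˡ j)
  loaded (inj₂ (here refl)) = inj₁ x∈C′
  loaded (inj₂ (there j))   = inj₂ (∈-++⁺ʳ as j)
  cover′ : ∀ {s} → s ∈ S → s ∈ C′ ⊎ s ∈ as ++ bs
  cover′ s∈S = [ inj₁ ∘ keep s∈S , loaded ∘ ∈-++⁻ as ]′ (cover s∈S)

-- C′ is the state in which an optimal policy for xs alone leaves the cache.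

optimalMisses-++ : ∀ k {C} xs ys → Unique C →
  ∃[ C′ ] Unique C′ × optimalMisses k C (xs ++ ys) ≤ optimalMisses k C xs + optimalMisses k C′ ys
optimalMisses-++ k {C} []       ys u = C , u , ≤-refl
optimalMisses-++ k {C} (x ∷ xs) ys u with x ∈? C
... | yes _ = optimalMisses-++ k xs ys u
... | no x∉C
  with C₁ , i , eq ← minOver-attained (λ C′ → optimalMisses k C′ xs) (afterMiss k x C)
  with C₂ , u₂ , le ← optimalMisses-++ k xs ys (afterMiss-unique k x∉C u i) =
  C₂ , u₂ , s≤s (≤-trans (minOver-≤ _ (afterMiss k x C) i)
    (subst (λ z → _ ≤ z + optimalMisses k C₂ ys) (sym eq) le))

optimalMisses-≤-length : ∀ k C xs → optimalMisses k C xs ≤ length xs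
optimalMisses-≤-length k C [] = z≤n
optimalMisses-≤-length k C (x ∷ xs) with x ∈? C
... | yes _ = m≤n⇒m≤1+n (optimalMisses-≤-length k C xs)
... | no _
  with C₁ , i , eq ← minOver-attained (λ C′ → optimalMisses k C′ xs) (afterMiss k x C) =
  s≤s (≤-trans (≤-reflexive eq) (optimalMisses-≤-length k C₁ xs))

-- Arithmetic and finite sums

-- The function l ↦ μ ⊔ l absorbs a halving split as long as both halves are at
-- least μ.  With μ = 1 it bounds how many kernels meet an item, and for larger μ,
-- after division by μ, how many views that fit in the cache do.

⊔-halves : ∀ {μ} l → μ ≤ ⌊ l /2⌋ → (μ ⊔ ⌈ l /2⌉) + (μ ⊔ ⌊ l /2⌋) ≤ μ ⊔ l
⊔-halves {μ} l μ≤ = begin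
  (μ ⊔ ⌈ l /2⌉) + (μ ⊔ ⌊ l /2⌋)
    ≡⟨ cong₂ _+_ (m≤n⇒m⊔n≡n (≤-trans μ≤ (⌊n/2⌋≤⌈n/2⌉ l))) (m≤n⇒m⊔n≡n μ≤) ⟩
  ⌈ l /2⌉ + ⌊ l /2⌋  ≡⟨ +-comm ⌈ l /2⌉ _ ⟩
  ⌊ l /2⌋ + ⌈ l /2⌉  ≡⟨ ⌊n/2⌋+⌈n/2⌉≡n l ⟩
  l                  ≤⟨ m≤n⊔m μ l ⟩
  μ ⊔ l              ∎
  where open ≤-Reasoning

sum-tabulate-≤ : ∀ {n} (g : Fin n → ℕ) {c G} → (∀ d → g d + c ≤ G) →
  sum (tabulate g) + n * c ≤ n * G
sum-tabulate-≤ {zero}  g h = z≤n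
sum-tabulate-≤ {suc n} g {c} {G} h = begin
  (g zero + S) + (c + n * c)  ≡⟨ interchange (g zero) S c (n * c) ⟩
  (g zero + c) + (S + n * c)  ≤⟨ +-mono-≤ (h zero) (sum-tabulate-≤ (g ∘ suc) (h ∘ suc)) ⟩
  G + n * G                   ∎
  where
  open ≤-Reasoning
  S = sum (tabulate (g ∘ suc))
  interchange : ∀ w x y z → (w + x) + (y + z) ≡ (w + y) + (x + z)
  interchange = solve-∀

max-tabulate-≤ : ∀ {n} (g : Fin n → ℕ) {G} → (∀ d → g d ≤ G) → foldr _⊔_ 0 (tabulate g) ≤ G
max-tabulate-≤ {zero}  g h = z≤n
max-tabulate-≤ {suc n} g h = ⊔-lub (h zero) (max-tabulate-≤ (g ∘ suc) (h ∘ suc))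

-- An upper bound for f on an initial segment.

bounded : (f : ℕ → ℕ) (n : ℕ) → ∃[ K ] ∀ {i} → i ≤ n → f i ≤ K
bounded f zero    = f 0 , λ { z≤n → ≤-refl }
bounded f (suc n) with K , h ← bounded f n = K ⊔ f (suc n) , bound
  where
  bound : ∀ {i} → i ≤ suc n → f i ≤ K ⊔ f (suc n)
  bound i≤ with m≤n⇒m<n∨m≡n i≤
  ... | inj₁ i<   = ≤-trans (h (≤-pred i<)) (m≤m⊔n K _)
  ... | inj₂ refl = m≤n⊔m K _

-- Sizes of the views met by the scheduler

module _ {b : ℕ} where

  -- The base-b logarithms ℓ of the transform length and digits of the number of
  -- items, and the number of items itself.

  ℓ digits items : View b → ℕ
  ℓ v      = length (transform v)
  digits v = ℓ v + (length (outer v) + length (contig v))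
  items v  = size v * batch v

  items≡b^digits : ∀ v → items v ≡ b ^ digits v
  items≡b^digits v = sym (^-distribˡ-+-* b (ℓ v) _)

  digits-fixOuter : ∀ v i d → suc (digits (fixOuter v i d)) ≡ digits v
  digits-fixOuter (view T O C F) i d = trans (sym (+-suc (length T) _))
    (cong (λ n → length T + (n + length C)) (sym (length-removeAt′ O i)))

  digits-fixContig : ∀ v {j C′} d → contig v ≡ j ∷ C′ →
    suc (digits (fixContig v j C′ d)) ≡ digits v
  digits-fixContig (view T O (j ∷ C′) F) d refl = trans (sym (+-suc (length T) _))
    (cong (length T +_) (sym (+-suc (length O) _)))

  ℓ-first : ∀ v → ℓ (first v) ≡ ⌈ ℓ v /2⌉
  ℓ-first v = trans (length-take ⌈ ℓ v /2⌉ (transform v)) (m≤n⇒m⊓n≡m (⌈n/2⌉≤n (ℓ v)))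

  ℓ-second : ∀ v → ℓ (second v) ≡ ⌊ ℓ v /2⌋
  ℓ-second v = trans (length-drop ⌈ ℓ v /2⌉ (transform v))
    (trans (cong (_∸ ⌈ ℓ v /2⌉) (sym (⌊n/2⌋+⌈n/2⌉≡n (ℓ v)))) (m+n∸n≡m ⌊ ℓ v /2⌋ ⌈ ℓ v /2⌉))

  private
    digits-move : ∀ (X Y O C : List ℕ) {l} → length X + length Y ≡ l →
      length X + (length (Y ++ O) + length C) ≡ l + (length O + length C)
    digits-move X Y O C refl rewrite length-++ Y {O} =
      assoc (length X) (length Y) (length O) (length C)
      where
      assoc : ∀ x y o c → x + (y + o + c) ≡ x + y + (o + c)
      assoc = solve-∀

    halves : ∀ v → ℓ (first v) + ℓ (second v) ≡ ℓ v
    halves v = trans (cong₂ _+_ (ℓ-first v) (ℓ-second v))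
      (trans (+-comm ⌈ ℓ v /2⌉ _) (⌊n/2⌋+⌈n/2⌉≡n (ℓ v)))

  digits-first : ∀ v → digits (first v) ≡ digits v
  digits-first v = digits-move (T₁ v) (T₂ v) (outer v) (contig v) (halves v)

  digits-second : ∀ v → digits (second v) ≡ digits v
  digits-second v = digits-move (T₂ v) (T₁ v) (outer v) (contig v)
    (trans (+-comm (length (T₂ v)) _) (halves v))

  items-child : ∀ v′ v → suc (digits v′) ≡ digits v → b * items v′ ≡ items v
  items-child v′ v eq = trans (cong (b *_) (items≡b^digits v′))
    (trans (cong (b ^_) eq) (sym (items≡b^digits v)))

  items-same : ∀ v′ v → digits v′ ≡ digits v → items v′ ≡ items v
  items-same v′ v eq = trans (items≡b^digits v′) (trans (cong (b ^_) eq) (sym (items≡b^digits v)))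

module _ {b : ℕ} (1<b : 1 < b) where

  private instance
    b≢0 : NonZero b
    b≢0 = >-nonZero (<-trans z<s 1<b)

  -- All parts of a batch split have the same sizes; part d₀ stands for them.

  d₀ : Fin b
  d₀ = fromℕ< (<-trans z<s 1<b)

  ^≤base : ∀ {k} → k ≤ 1 → b ^ k ≤ b
  ^≤base {k} k≤1 = subst (b ^ k ≤_) (^-identityʳ b) (^-monoʳ-≤ b k≤1)

  ^≤base⁻ : ∀ {k} → b ^ k ≤ b → k ≤ 1
  ^≤base⁻ {zero}        h = z≤n
  ^≤base⁻ {suc zero}    h = ≤-refl
  ^≤base⁻ {suc (suc k)} h = contradiction
    (subst (b ^ (2 + k) ≤_) (sym (^-identityʳ b)) h)
    (<⇒≱ (^-monoʳ-< b 1<b (s≤s (s≤s (z≤n {k})))))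

  items-positive : (v : View b) → 1 ≤ items v
  items-positive v = subst (1 ≤_) (sym (items≡b^digits v)) (m^n>0 b (digits v))

  split⇒2≤ℓ : (v : View b) → ¬ Base v → batch v < size v → 2 ≤ ℓ v
  split⇒2≤ℓ v ¬base s<n =
    ≰⇒> λ ℓ≤1 → ¬base (^≤base ℓ≤1 , ≤-trans (<⇒≤ s<n) (^≤base ℓ≤1))

  -- A cost of executions that is at most k at a kernel, at most c plus the total
  -- cost of the recursive calls at a split, and at a transform split at most w per
  -- item on top of that.

  record Additive (cost : (v : View b) → Exec v → ℕ) (k c w : ℕ) : Set where
    field
      kernel≤ : ∀ v (p : Base v) → cost v (kernel p) ≤ k
      outer≤  : ∀ v p q i es →
        cost v (splitOuter p q i es) ≤ c + sum (tabulate λ d → cost (fixOuter v i d) (es d))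
      contig≤ : ∀ v p q r j C′ r′ es →
        cost v (splitContig p q r j C′ r′ es)
          ≤ c + sum (tabulate λ d → cost (fixContig v j C′ d) (es d))
      transform≤ : ∀ v p q e₁ e₂ →
        cost v (splitTransform p q e₁ e₂)
          ≤ c + cost (first v) e₁ + cost (second v) e₂ + w * items v

  module _ {cost : (v : View b) → Exec v → ℕ} {k c w : ℕ} (add : Additive cost k c w) where
    open Additive add

    -- The factor in front of N (1 ⊔ ℓ) in the resulting bound.

    rate : ℕ
    rate = k + c + w

    -- The slack c + w N makes the induction close: at a split the slacks of the
    -- recursive calls pay for the split itself and for the slack of the whole, since
    -- the parts of a batch split contribute b c ≥ 2 c, and the stages of a transform
    -- split contribute 2 (c + w N).

    cost+slack-≤ : ∀ v (e : Exec v) → cost v e + (c + w * items v) ≤ rate * items v * (1 ⊔ ℓ v)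

    private
      batch-split : ∀ v {N′ x} (g : Fin b → ℕ) → b * N′ ≡ items v →
        (∀ d → g d + (c + w * N′) ≤ rate * N′ * (1 ⊔ ℓ v)) →
        x ≤ c + sum (tabulate g) →
        x + (c + w * items v) ≤ rate * items v * (1 ⊔ ℓ v)
      batch-split v {N′} {x} g N≡ child x≤ = begin
        x + (c + w * N)              ≤⟨ +-monoˡ-≤ _ x≤ ⟩
        (c + S) + (c + w * N)        ≡⟨ cong (λ n → (c + S) + (c + w * n)) (sym N≡) ⟩
        (c + S) + (c + w * (b * N′)) ≡⟨ collect c S w b N′ ⟩
        S + (2 * c + b * (w * N′))   ≤⟨ +-monoʳ-≤ S (+-monoˡ-≤ _ (*-monoˡ-≤ c 1<b)) ⟩
        S + (b * c + b * (w * N′))   ≡⟨ cong (S +_) (*-distribˡ-+ b c _) ⟨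
        S + b * (c + w * N′)         ≤⟨ sum-tabulate-≤ g child ⟩
        b * (rate * N′ * (1 ⊔ ℓ v))  ≡⟨ scale b rate N′ (1 ⊔ ℓ v) ⟩
        rate * (b * N′) * (1 ⊔ ℓ v)  ≡⟨ cong (λ n → rate * n * (1 ⊔ ℓ v)) N≡ ⟩
        rate * N * (1 ⊔ ℓ v)         ∎
        where
        open ≤-Reasoning
        N = items v
        S = sum (tabulate g)
        collect : ∀ c S w b N → (c + S) + (c + w * (b * N)) ≡ S + (2 * c + b * (w * N))
        collect = solve-∀
        scale : ∀ b r N m → b * (r * N * m) ≡ r * (b * N) * m
        scale = solve-∀

    cost+slack-≤ v (kernel p) = begin
      cost v (kernel p) + (c + w * N)  ≤⟨ +-mono-≤ (≤-trans (kernel≤ v p) (up k)) (+-monoˡ-≤ _ (up c)) ⟩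
      k * N + (c * N + w * N)          ≡⟨ collect k c w N ⟩
      rate * N                         ≡⟨ *-identityʳ (rate * N) ⟨
      rate * N * 1                     ≤⟨ *-monoʳ-≤ (rate * N) (m≤m⊔n 1 (ℓ v)) ⟩
      rate * N * (1 ⊔ ℓ v)             ∎
      where
      open ≤-Reasoning
      N = items v
      up : ∀ x → x ≤ x * N
      up x = m≤m*n x N {{>-nonZero (items-positive v)}}
      collect : ∀ k c w N → k * N + (c * N + w * N) ≡ (k + c + w) * N
      collect = solve-∀
    cost+slack-≤ v (splitOuter p q i es) =
      batch-split v _ (items-child (fixOuter v i d₀) v (digits-fixOuter v i d₀))
        (λ d → cost+slack-≤ (fixOuter v i d) (es d)) (outer≤ v p q i es)
    cost+slack-≤ v (splitContig p q r j C′ r′ es) =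
      batch-split v _ (items-child (fixContig v j C′ d₀) v (digits-fixContig v d₀ r′))
        (λ d → cost+slack-≤ (fixContig v j C′ d) (es d)) (contig≤ v p q r j C′ r′ es)
    cost+slack-≤ v (splitTransform p q e₁ e₂) = begin
      cost v (splitTransform p q e₁ e₂) + (c + w * N) ≤⟨ +-monoˡ-≤ _ (transform≤ v p q e₁ e₂) ⟩
      (c + x₁ + x₂ + w * N) + (c + w * N)           ≡⟨ collect c x₁ x₂ (w * N) ⟩
      (x₁ + (c + w * N)) + (x₂ + (c + w * N))
        ≤⟨ +-mono-≤
             (subst₂ (λ n l → x₁ + (c + w * n) ≤ rate * n * (1 ⊔ l))
               (items-same (first v) v (digits-first v)) (ℓ-first v) (cost+slack-≤ (first v) e₁))
             (subst₂ (λ n l → x₂ + (c + w * n) ≤ rate * n * (1 ⊔ l))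
               (items-same (second v) v (digits-second v)) (ℓ-second v) (cost+slack-≤ (second v) e₂)) ⟩
      rate * N * (1 ⊔ ⌈ ℓ v /2⌉) + rate * N * (1 ⊔ ⌊ ℓ v /2⌋) ≡⟨ *-distribˡ-+ (rate * N) _ _ ⟨
      rate * N * ((1 ⊔ ⌈ ℓ v /2⌉) + (1 ⊔ ⌊ ℓ v /2⌋))
        ≤⟨ *-monoʳ-≤ (rate * N) (⊔-halves (ℓ v) (⌊n/2⌋-mono (split⇒2≤ℓ v p q))) ⟩
      rate * N * (1 ⊔ ℓ v) ∎
      where
      open ≤-Reasoning
      N  = items v
      x₁ = cost (first v) e₁
      x₂ = cost (second v) e₂
      collect : ∀ c x y z → (c + x + y + z) + (c + z) ≡ (x + (c + z)) + (y + (c + z))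
      collect = solve-∀

    cost-≤ : ∀ v (e : Exec v) → cost v e ≤ rate * items v * (1 ⊔ ℓ v)
    cost-≤ v e = m+n≤o⇒m≤o _ (cost+slack-≤ v e)

  base⇒digits≤1 : ∀ (v : View b) → Base v →
    ℓ v ≤ 1 × length (outer v) ≤ 1 × length (contig v) ≤ 1
  base⇒digits≤1 v (n≤b , s≤b) = ^≤base⁻ n≤b ,
    m+n≤o⇒m≤o (length (outer v)) (^≤base⁻ s≤b) , m+n≤o⇒n≤o (length (outer v)) (^≤base⁻ s≤b)

  -- Work, trace length and recursion stack

  module _ (I : Implementation b) where
    open Implementation I

    work-additive : ∃[ k ] Additive (λ v → work I {v}) k callWork twiddleWork
    work-additive = callWork + K , record
      { kernel≤    = λ v (n≤b , s≤b) → +-monoʳ-≤ callWork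
          (≤-trans (proj₂ (bounded (kernelWork (size v)) b) s≤b)
                   (proj₂ (bounded row b) n≤b))
      ; outer≤     = λ _ _ _ _ _ → ≤-refl
      ; contig≤    = λ _ _ _ _ _ _ _ _ → ≤-refl
      ; transform≤ = λ _ _ _ _ _ → ≤-refl
      }
      where
      row : ℕ → ℕ
      row n = proj₁ (bounded (kernelWork n) b)
      K : ℕ
      K = proj₁ (bounded row b)

    length-trace-additive : ∃[ k ] Additive (λ v e → length (trace I {v} e)) k 0 0
    length-trace-additive = K , record
      { kernel≤    = λ v p → let l≤ , o≤ , c≤ = base⇒digits≤1 v p in
          subst (_≤ K) (sym (length-map (address v) (kernelAccesses (ℓ v) (length (outer v)) (length (contig v)))))
            (≤-trans (proj₂ (kern₁ (ℓ v) (length (outer v))) c≤)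
              (≤-trans (proj₂ (kern₂ (ℓ v)) o≤) (proj₂ kern₃ l≤)))
      ; outer≤     = λ _ _ _ _ es → length-concat≤ (λ d → trace I (es d))
      ; contig≤    = λ _ _ _ _ _ _ _ es → length-concat≤ (λ d → trace I (es d))
      ; transform≤ = λ _ _ _ e₁ e₂ →
          ≤-reflexive (trans (length-++ (trace I e₁)) (sym (+-identityʳ _)))
      }
      where
      kern₁ : ∀ l o → ∃[ K ] (∀ {c} → c ≤ 1 → length (kernelAccesses l o c) ≤ K)
      kern₁ l o = bounded (λ c → length (kernelAccesses l o c)) 1
      kern₂ : ∀ l → ∃[ K ] (∀ {o} → o ≤ 1 → proj₁ (kern₁ l o) ≤ K)
      kern₂ l = bounded (λ o → proj₁ (kern₁ l o)) 1
      kern₃ : ∃[ K ] (∀ {l} → l ≤ 1 → proj₁ (kern₂ l) ≤ K)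
      kern₃ = bounded (λ l → proj₁ (kern₂ l)) 1
      K = proj₁ kern₃
      length-concat≤ : ∀ {n} (xs : Fin n → List ℕ) →
        length (concat (tabulate xs)) ≤ sum (tabulate λ d → length (xs d))
      length-concat≤ {zero}  xs = z≤n
      length-concat≤ {suc n} xs = subst (_≤ length (xs zero) + sum (tabulate λ d → length (xs (suc d)))) (sym (length-++ (xs zero)))
        (+-monoʳ-≤ (length (xs zero)) (length-concat≤ (xs ∘ suc)))

    -- Every recursive call decreases ℓ + digits: a batch split removes one digit,
    -- and a transform split keeps all digits but shortens the transform.

    stackWords-≤ : ∀ {v} (e : Exec v) → stackWords I e ≤ frameWords * suc (ℓ v + digits v)
    stackWords-≤ (kernel _) = m≤m*n frameWords _
    stackWords-≤ {v} (splitOuter p q i es) = begin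
      frameWords + foldr _⊔_ 0 (tabulate λ d → stackWords I (es d))
        ≤⟨ +-monoʳ-≤ frameWords (max-tabulate-≤ _ λ d → subst (λ n → stackWords I (es d) ≤ frameWords * n)
             (trans (sym (+-suc (ℓ v) _)) (cong (ℓ v +_) (digits-fixOuter v i d))) (stackWords-≤ (es d))) ⟩
      frameWords + frameWords * (ℓ v + digits v) ≡⟨ *-suc frameWords _ ⟨
      frameWords * suc (ℓ v + digits v) ∎
      where open ≤-Reasoning
    stackWords-≤ {v} (splitContig p q r j C′ r′ es) = begin
      frameWords + foldr _⊔_ 0 (tabulate λ d → stackWords I (es d))
        ≤⟨ +-monoʳ-≤ frameWords (max-tabulate-≤ _ λ d → subst (λ n → stackWords I (es d) ≤ frameWords * n)
             (trans (sym (+-suc (ℓ v) _)) (cong (ℓ v +_) (digits-fixContig v d r′))) (stackWords-≤ (es d))) ⟩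
      frameWords + frameWords * (ℓ v + digits v) ≡⟨ *-suc frameWords _ ⟨
      frameWords * suc (ℓ v + digits v) ∎
      where open ≤-Reasoning
    stackWords-≤ {v} (splitTransform p q e₁ e₂) = begin
      frameWords + (stackWords I e₁ ⊔ stackWords I e₂)
        ≤⟨ +-monoʳ-≤ frameWords (⊔-lub
             (≤-trans (stackWords-≤ e₁) (*-monoʳ-≤ frameWords (+-mono-<-≤ first< (≤-reflexive (digits-first v)))))
             (≤-trans (stackWords-≤ e₂) (*-monoʳ-≤ frameWords (+-mono-<-≤ second< (≤-reflexive (digits-second v)))))) ⟩
      frameWords + frameWords * (ℓ v + digits v) ≡⟨ *-suc frameWords _ ⟨
      frameWords * suc (ℓ v + digits v) ∎
      where
      open ≤-Reasoning
      ⌈/2⌉< : ∀ {n} → 2 ≤ n → ⌈ n /2⌉ < n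
      ⌈/2⌉< {suc (suc n)} _ = ⌈n/2⌉<n n
      ⌈/2⌉< {1} (s≤s ())
      first< : ℓ (first v) < ℓ v
      first< = subst (_< ℓ v) (sym (ℓ-first v)) (⌈/2⌉< (split⇒2≤ℓ v p q))
      second< : ℓ (second v) < ℓ v
      second< = subst (_< ℓ v) (sym (ℓ-second v))
        (≤-<-trans (⌊n/2⌋≤⌈n/2⌉ (ℓ v)) (⌈/2⌉< (split⇒2≤ℓ v p q)))

-- Lists and division

↭-removeAt : ∀ {A : Set} (xs : List A) i → xs ↭ lookup xs i ∷ removeAt xs i
↭-removeAt (x ∷ xs) zero    = ↭.refl
↭-removeAt (x ∷ xs) (suc i) = ↭-trans (prep x (↭-removeAt xs i)) (swap x _ ↭.refl)

length-cartesianProductWith : ∀ {A B C : Set} (f : A → B → C) xs ys →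
  length (cartesianProductWith f xs ys) ≡ length xs * length ys
length-cartesianProductWith f []       ys = refl
length-cartesianProductWith f (x ∷ xs) ys = trans (length-++ (map (f x) ys))
  (cong₂ _+_ (length-map (f x) ys) (length-cartesianProductWith f xs ys))

m<[1+m/n]*n : ∀ m n .{{_ : NonZero n}} → m < suc (m / n) * n
m<[1+m/n]*n m n = subst (_< n + m / n * n) (sym (m≡m%n+[m/n]*n m n)) (+-monoˡ-< _ (m%n<n m n))

[m+n]/o< : ∀ m {n w} o .{{_ : NonZero o}} → n < w → (m + n) / o < m / o + (w / o + 2)
[m+n]/o< m {n} {w} o n<w = m<n*o⇒m/o<n (begin-strict
  m + n                             <⟨ +-mono-< (m<[1+m/n]*n m o) (<-trans n<w (m<[1+m/n]*n w o)) ⟩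
  suc (m / o) * o + suc (w / o) * o ≡⟨ collect (m / o) (w / o) o ⟩
  (m / o + (w / o + 2)) * o         ∎)
  where
  open ≤-Reasoning
  collect : ∀ x y o → (1 + x) * o + (1 + y) * o ≡ (x + (y + 2)) * o
  collect = solve-∀

-- Addresses of the items of a view

module _ {b : ℕ} where

  -- The values that the digit slots js contribute to an address as their digits
  -- vary.

  data IsOffset : List ℕ → ℕ → Set where
    []  : IsOffset [] 0
    _∷_ : ∀ {j js a} (d : Fin b) → IsOffset js a → IsOffset (j ∷ js) (toℕ d * b ^ j + a)

  isOffset-offset : ∀ js (ds : Vec (Fin b) (length js)) → IsOffset js (offset js ds)
  isOffset-offset []       []       = []
  isOffset-offset (j ∷ js) (d ∷ ds) = d ∷ isOffset-offset js ds

  isOffset-++ : ∀ {js ks x y} → IsOffset js x → IsOffset ks y → IsOffset (js ++ ks) (x + y)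
  isOffset-++ []                p = p
  isOffset-++ {ks = ks} (_∷_ {j} {js} {a} d q) p =
    subst (IsOffset (j ∷ js ++ ks)) (sym (+-assoc (toℕ d * b ^ j) a _)) (d ∷ isOffset-++ q p)

  isOffset-↭ : ∀ {js ks x} → js ↭ ks → IsOffset js x → IsOffset ks x
  isOffset-↭ ↭.refl        p           = p
  isOffset-↭ (prep j π)    (d ∷ p)     = d ∷ isOffset-↭ π p
  isOffset-↭ (swap {js} {ks} j k π)  (_∷_ {a = a} d (_∷_ {a = a′} d′ p)) =
    subst (IsOffset (k ∷ j ∷ ks)) (exchange (toℕ d * b ^ j) (toℕ d′ * b ^ k) a′) (d′ ∷ d ∷ isOffset-↭ π p)
    where
    exchange : ∀ x y z → y + (x + z) ≡ x + (y + z)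
    exchange = solve-∀
  isOffset-↭ (↭.trans π ρ) p           = isOffset-↭ ρ (isOffset-↭ π p)

  isOffset-downFrom< : ∀ n {x} → IsOffset (downFrom n) x → x < b ^ n
  isOffset-downFrom< zero    []                   = z<s
  isOffset-downFrom< (suc n) (_∷_ {a = a} d p) = begin-strict
    toℕ d * b ^ n + a      <⟨ +-monoʳ-< (toℕ d * b ^ n) (isOffset-downFrom< n p) ⟩
    toℕ d * b ^ n + b ^ n  ≡⟨ +-comm _ (b ^ n) ⟩
    suc (toℕ d) * b ^ n    ≤⟨ *-monoˡ-≤ (b ^ n) (toℕ<n d) ⟩
    b * b ^ n              ∎
    where open ≤-Reasoning

  -- The values described by IsOffset, one for each choice of digits.

  offsets : List ℕ → List ℕ
  offsets []       = [ 0 ]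
  offsets (j ∷ js) = cartesianProductWith (λ d a → toℕ d * b ^ j + a) (allFin b) (offsets js)

  isOffset⇒∈ : ∀ {js x} → IsOffset js x → x ∈ offsets js
  isOffset⇒∈ []      = here refl
  isOffset⇒∈ (d ∷ p) = ∈-cartesianProductWith⁺ _ (∈-allFin d) (isOffset⇒∈ p)

  length-offsets : ∀ js → length (offsets js) ≡ b ^ length js
  length-offsets []       = refl
  length-offsets (j ∷ js) = trans (length-cartesianProductWith _ (allFin b) (offsets js))
    (cong₂ _*_ (length-tabulate {n = b} (λ d → d)) (length-offsets js))

  -- a is the address of an item of v: start selects a contiguous run of items, and
  -- shift is the position within that run.

  record Item (v : View b) (a : ℕ) : Set where
    constructor item
    field
      {start shift} : ℕ
      isStart : IsOffset (transform v ++ outer v) start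
      isShift : IsOffset (contig v) shift
      is+     : a ≡ start + shift + fixedOffset (fixed v)

  item-address : ∀ v x → Item v (address v x)
  item-address v (x , y , z) = item
    (isOffset-++ (isOffset-offset (transform v) x) (isOffset-offset (outer v) y))
    (isOffset-offset (contig v) z) refl

  item-fixOuter : ∀ v i d {a} → Item (fixOuter v i d) a → Item v a
  item-fixOuter v@(view T O C F) i d (item {x} {z} p q eq) = item
    (isOffset-↭ (↭-sym (↭-trans (↭.++⁺ˡ T (↭-removeAt O i)) (↭.shift (lookup O i) T (removeAt O i)))) (d ∷ p))
    q (trans eq (move (toℕ d * b ^ lookup O i) x z (fixedOffset F)))
    where
    move : ∀ y x z f → x + z + (y + f) ≡ y + x + z + f
    move = solve-∀

  item-fixContig : ∀ v {j C′} d {a} → contig v ≡ j ∷ C′ → Item (fixContig v j C′ d) a → Item v a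
  item-fixContig v@(view T O C F) {j} d refl (item {x} {z} p q eq) = item p (d ∷ q)
    (trans eq (move (toℕ d * b ^ j) x z (fixedOffset F)))
    where
    move : ∀ y x z f → x + z + (y + f) ≡ x + (y + z) + f
    move = solve-∀

  item-first : ∀ v {a} → Item (first v) a → Item v a
  item-first v (item p q eq) = item (isOffset-↭ (↭-reflexive (trans
    (sym (++-assoc (T₁ v) (T₂ v) (outer v)))
    (cong (_++ outer v) (take++drop≡id ⌈ ℓ v /2⌉ (transform v))))) p) q eq

  item-second : ∀ v {a} → Item (second v) a → Item v a
  item-second v (item p q eq) =
    item-first v (item (isOffset-↭ (↭.shifts (T₂ v) (T₁ v) {outer v}) p) q eq)

  all-concat-tabulate : ∀ {n} {P : ℕ → Set} (xs : Fin n → List ℕ) →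
    (∀ d → All P (xs d)) → All P (concat (tabulate xs))
  all-concat-tabulate xs h = All.concat⁺ (All.tabulate⁺ h)

  trace-items : ∀ (I : Implementation b) {v} (e : Exec v) → All (Item v) (trace I e)
  trace-items I {v} (kernel _) = All.tabulate λ i → case (∈-map⁻ (address v) i)
    where
    case : ∀ {a xs} → ∃[ x ] x ∈ xs × a ≡ address v x → Item v a
    case (x , _ , refl) = item-address v x
  trace-items I {v} (splitOuter _ _ i es) = all-concat-tabulate _ λ d →
    All.map (item-fixOuter v i d) (trace-items I (es d))
  trace-items I {v} (splitContig _ _ _ j C′ r es) = all-concat-tabulate _ λ d →
    All.map (item-fixContig v d r) (trace-items I (es d))
  trace-items I {v} (splitTransform _ _ e₁ e₂) = All.++⁺
    (All.map (item-first v) (trace-items I e₁)) (All.map (item-second v) (trace-items I e₂))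

  -- The batch digits C occupy the slots 0, …, |C| - 1, so that they address a run of
  -- width v consecutive words.

  Contiguous : View b → Set
  Contiguous v = contig v ≡ downFrom (length (contig v))

  contiguous-tail : ∀ {j : ℕ} {C} → j ∷ C ≡ downFrom (length (j ∷ C)) → C ≡ downFrom (length C)
  contiguous-tail = cong (drop 1)

  module _ (B : ℕ) .{{_ : NonZero B}} where

    -- The blocks met by the runs of v.  A run of w words meets at most w / B + 2
    -- consecutive blocks, the first of which contains the start of the run.  A block
    -- shared by several runs is listed several times, which only weakens the bounds.

    blocks : View b → List ℕ
    blocks v = cartesianProductWith (λ x i → (x + fixedOffset (fixed v)) / B + i)
      (offsets (transform v ++ outer v)) (upTo (width v / B + 2))

    item⇒∈blocks : ∀ v {a} → Contiguous v → Item v a → a / B ∈ blocks v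
    item⇒∈blocks v cont (item {x} {z} p q refl) =
      subst (_∈ blocks v) block≡ (∈-cartesianProductWith⁺ _ (isOffset⇒∈ p) (∈-upTo⁺ index<))
      where
      run = x + fixedOffset (fixed v)
      z< : z < width v
      z< = isOffset-downFrom< (length (contig v)) (subst (λ js → IsOffset js z) cont q)
      address≡ : x + z + fixedOffset (fixed v) ≡ run + z
      address≡ = trans (+-assoc x z _) (trans (cong (x +_) (+-comm z _)) (sym (+-assoc x _ z)))
      index = (run + z) / B ∸ run / B
      index< : index < width v / B + 2
      index< = m<n+o⇒m∸n<o ((run + z) / B) (run / B)
        {{subst NonZero (sym (+-comm _ 2)) _}} ([m+n]/o< run B z<)
      block≡ : run / B + index ≡ (x + z + fixedOffset (fixed v)) / B
      block≡ = trans (m+[n∸m]≡n (/-monoˡ-≤ B (m≤m+n run z))) (cong (_/ B) (sym address≡))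

    -- As long as runs have length at least B / H, the two boundary blocks of each run
    -- cost only a constant factor.

    blocks-≤ : ∀ v H → B ≤ H * width v → length (blocks v) * B ≤ (1 + 2 * H) * items v
    blocks-≤ v H B≤ = begin
      length (blocks v) * B      ≡⟨ cong (_* B) length≡ ⟩
      b ^ r * (w / B + 2) * B    ≡⟨ *-assoc (b ^ r) _ B ⟩
      b ^ r * ((w / B + 2) * B)  ≡⟨ cong (b ^ r *_) (*-distribʳ-+ B (w / B) 2) ⟩
      b ^ r * (w / B * B + 2 * B) ≤⟨ *-monoʳ-≤ (b ^ r) (+-mono-≤ (m/n*n≤m w B) (*-monoʳ-≤ 2 B≤)) ⟩
      b ^ r * (w + 2 * (H * w))  ≡⟨ collect (b ^ r) w H ⟩
      (1 + 2 * H) * (b ^ r * w)  ≡⟨ cong ((1 + 2 * H) *_) items≡ ⟩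
      (1 + 2 * H) * items v      ∎
      where
      open ≤-Reasoning
      r = length (transform v ++ outer v)
      w = width v
      length≡ : length (blocks v) ≡ b ^ r * (w / B + 2)
      length≡ = trans (length-cartesianProductWith _ (offsets (transform v ++ outer v)) _)
        (cong₂ _*_ (length-offsets (transform v ++ outer v)) (length-upTo _))
      items≡ : b ^ r * w ≡ items v
      items≡ = trans (sym (^-distribˡ-+-* b r _)) (trans
        (cong (b ^_) (trans (cong (_+ length (contig v)) (length-++ (transform v)))
          (+-assoc (ℓ v) _ _)))
        (sym (items≡b^digits v)))
      collect : ∀ x w H → x * (w + 2 * (H * w)) ≡ (1 + 2 * H) * (x * w)
      collect = solve-∀

-- Cache misses in a large cache

-- H bounds the factor by which the width may fall below B, and a view is known to
-- fit in the cache once E times its number of items is at most M: then H-E bounds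
-- the blocks that it meets.  E-H makes a view fit before its width becomes too small,
-- E-M makes every view fit at which a kernel is called, and deep says that a view
-- with s < n that does not fit has both halves of its transform digits at least μ
-- long.

module _ {b : ℕ} (1<b : 1 < b) (I : Implementation b)
  (M B κ H E μ : ℕ) .{{_ : NonZero B}} .{{_ : NonZero H}}
  (tall : B * B ≤ κ * M)
  (H-E : 1 + 2 * H ≤ E) (E-H : b * b * E * κ ≤ H * H)
  (E-M : E * (b * b) ≤ M)
  (deep : ∀ l → M < E * (b ^ l * b ^ l) → μ ≤ ⌊ l /2⌋)
  where

  private instance
    b≢0 : NonZero b
    b≢0 = >-nonZero (<-trans z<s 1<b)

  -- A bound y on B μ times the misses caused by the addresses xs, whatever the
  -- initial state of the cache.

  Misses≤ : List ℕ → ℕ → Set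
  Misses≤ xs y = ∀ C → Unique C → optimalMisses (M / B) C (map (_/ B) xs) * (B * μ) ≤ y

  misses-++ : ∀ xs ys {x y} → Misses≤ xs x → Misses≤ ys y → Misses≤ (xs ++ ys) (x + y)
  misses-++ xs ys {x} {y} p q C u
    with C′ , u′ , le ← optimalMisses-++ (M / B) (map (_/ B) xs) (map (_/ B) ys) u = begin
    optimalMisses (M / B) C (map (_/ B) (xs ++ ys)) * (B * μ)
      ≡⟨ cong (λ zs → optimalMisses (M / B) C zs * (B * μ)) (map-++ (_/ B) xs ys) ⟩
    optimalMisses (M / B) C (map (_/ B) xs ++ map (_/ B) ys) * (B * μ)
      ≤⟨ *-monoˡ-≤ (B * μ) le ⟩
    (optimalMisses (M / B) C (map (_/ B) xs) + optimalMisses (M / B) C′ (map (_/ B) ys)) * (B * μ)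
      ≡⟨ *-distribʳ-+ (B * μ) (optimalMisses (M / B) C (map (_/ B) xs)) _ ⟩
    optimalMisses (M / B) C (map (_/ B) xs) * (B * μ) + optimalMisses (M / B) C′ (map (_/ B) ys) * (B * μ)
      ≤⟨ +-mono-≤ (p C u) (q C′ u′) ⟩
    x + y ∎
    where open ≤-Reasoning

  misses-concat : ∀ {n y} (xs : Fin n → List ℕ) → (∀ d → Misses≤ (xs d) y) →
    Misses≤ (concat (tabulate xs)) (n * y)
  misses-concat {zero}  xs p = λ _ _ → z≤n
  misses-concat {suc n} xs p = misses-++ (xs zero) _ (p zero) (misses-concat (xs ∘ suc) (p ∘ suc))

  misses-batch : ∀ {N′} (xs : Fin b → List ℕ) (v : View b) → b * N′ ≡ items v →
    (∀ d → Misses≤ (xs d) (E * N′ * (μ ⊔ ℓ v))) →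
    Misses≤ (concat (tabulate xs)) (E * items v * (μ ⊔ ℓ v))
  misses-batch {N′} xs v N≡ p C u = begin
    optimalMisses (M / B) C (map (_/ B) (concat (tabulate xs))) * (B * μ)
                                  ≤⟨ misses-concat xs p C u ⟩
    b * (E * N′ * (μ ⊔ ℓ v))      ≡⟨ scale b E N′ (μ ⊔ ℓ v) ⟩
    E * (b * N′) * (μ ⊔ ℓ v)      ≡⟨ cong (λ n → E * n * (μ ⊔ ℓ v)) N≡ ⟩
    E * items v * (μ ⊔ ℓ v)       ∎
    where
    open ≤-Reasoning
    scale : ∀ b E N m → b * (E * N * m) ≡ E * (b * N) * m
    scale = solve-∀

  -- A view that fits is loaded once.

  misses-fit : ∀ v (e : Exec v) → Contiguous v → B ≤ H * width v → E * items v ≤ M →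
    Misses≤ (trace I e) (E * items v * (μ ⊔ ℓ v))
  misses-fit v e cont B≤ fits C u = begin
    optimalMisses (M / B) C (map (_/ B) (trace I e)) * (B * μ)
      ≤⟨ *-monoˡ-≤ (B * μ) (optimalMisses-⊆ (M / B) S S≤ S u inj₂ inS) ⟩
    length S * (B * μ)     ≡⟨ *-assoc (length S) B μ ⟨
    length S * B * μ       ≤⟨ *-mono-≤ S*B≤ (m≤m⊔n μ (ℓ v)) ⟩
    E * items v * (μ ⊔ ℓ v) ∎
    where
    open ≤-Reasoning
    S = blocks B v
    S*B≤ : length S * B ≤ E * items v
    S*B≤ = ≤-trans (blocks-≤ B v H B≤) (*-monoˡ-≤ (items v) H-E)
    S≤ : length S ≤ M / B
    S≤ = subst (_≤ M / B) (m*n/n≡m (length S) B) (/-monoˡ-≤ B (≤-trans S*B≤ fits))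
    inS : map (_/ B) (trace I e) ⊆ S
    inS i with a , j , refl ← ∈-map⁻ (_/ B) i = item⇒∈blocks B v cont (All.lookup (trace-items I e) j)

  -- Contiguous digits are only split when O = ∅ and n ≤ s = c, hence N ≤ c * c.
  -- If the new width were below B / H, then c < b B / H and the tall cache would give
  -- E H H N ≤ b b E κ M ≤ H H M, so that the view would already fit.

  width-fixContig : ∀ (v : View b) {j C′} → size v ≤ batch v → outer v ≡ [] → contig v ≡ j ∷ C′ →
    M < E * items v → B ≤ H * b ^ length C′
  width-fixContig v@(view T .[] .(j ∷ C′) F) {j} {C′} n≤s refl refl big =
    ≮⇒≥ λ narrow → <⇒≱ big (*-cancelˡ-≤ (H * H) {{m*n≢0 H H}} (begin
      H * H * (E * items v)            ≤⟨ *-monoʳ-≤ (H * H) (*-monoʳ-≤ E (*-monoˡ-≤ (batch v) n≤s)) ⟩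
      H * H * (E * (b * w * (b * w)))  ≡⟨ rearrange H E b w ⟩
      b * b * E * (H * w * (H * w))    ≤⟨ *-monoʳ-≤ (b * b * E) (*-mono-≤ (<⇒≤ narrow) (<⇒≤ narrow)) ⟩
      b * b * E * (B * B)              ≤⟨ *-monoʳ-≤ (b * b * E) tall ⟩
      b * b * E * (κ * M)              ≡⟨ *-assoc (b * b * E) κ M ⟨
      b * b * E * κ * M                ≤⟨ *-monoˡ-≤ M E-H ⟩
      H * H * M                        ∎))
    where
    open ≤-Reasoning
    w = b ^ length C′
    rearrange : ∀ H E b w → H * H * (E * (b * w * (b * w))) ≡ b * b * E * (H * w * (H * w))
    rearrange = solve-∀

  -- The recursion is followed down to the views that fit.  Their blocks number
  -- O (N / B), and ⊔-halves bounds how often an item is met by them.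

  misses-≤ : ∀ v (e : Exec v) → Contiguous v → B ≤ H * width v →
    Misses≤ (trace I e) (E * items v * (μ ⊔ ℓ v))
  misses-≤ v e cont B≤ with E * items v ≤? M
  misses-≤ v e cont B≤ | yes fits = misses-fit v e cont B≤ fits
  misses-≤ v (kernel (n≤b , s≤b)) cont B≤ | no big =
    contradiction (≤-trans (*-monoʳ-≤ E (*-mono-≤ n≤b s≤b)) E-M) big
  misses-≤ v (splitOuter p q i es) cont B≤ | no big =
    misses-batch (λ d → trace I (es d)) v
      (items-child (fixOuter v i (d₀ 1<b)) v (digits-fixOuter v i (d₀ 1<b)))
      (λ d → misses-≤ (fixOuter v i d) (es d) cont B≤)
  misses-≤ v (splitContig p q r j C′ r′ es) cont B≤ | no big =
    misses-batch (λ d → trace I (es d)) v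
      (items-child (fixContig v j C′ (d₀ 1<b)) v (digits-fixContig v (d₀ 1<b) r′))
      (λ d → misses-≤ (fixContig v j C′ d) (es d) (contiguous-tail {j} (subst Contig r′ cont)) (width-fixContig v q r r′ (≰⇒> big)))
    where
    Contig : List ℕ → Set
    Contig C = C ≡ downFrom (length C)
  misses-≤ v (splitTransform p q e₁ e₂) cont B≤ | no big = λ C u → begin
    optimalMisses (M / B) C (map (_/ B) (trace I e₁ ++ trace I e₂)) * (B * μ)
      ≤⟨ misses-++ (trace I e₁) (trace I e₂) (misses-≤ (first v) e₁ cont B≤) (misses-≤ (second v) e₂ cont B≤) C u ⟩
    E * items (first v) * (μ ⊔ ℓ (first v)) + E * items (second v) * (μ ⊔ ℓ (second v))
      ≡⟨ cong₂ _+_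
           (cong₂ (λ n l → E * n * (μ ⊔ l)) (items-same (first v) v (digits-first v)) (ℓ-first v))
           (cong₂ (λ n l → E * n * (μ ⊔ l)) (items-same (second v) v (digits-second v)) (ℓ-second v)) ⟩
    E * N * (μ ⊔ ⌈ ℓ v /2⌉) + E * N * (μ ⊔ ⌊ ℓ v /2⌋)
      ≡⟨ *-distribˡ-+ (E * N) _ _ ⟨
    E * N * ((μ ⊔ ⌈ ℓ v /2⌉) + (μ ⊔ ⌊ ℓ v /2⌋))
      ≤⟨ *-monoʳ-≤ (E * N) (⊔-halves (ℓ v) (deep (ℓ v)
           (<-≤-trans (≰⇒> big) (*-monoʳ-≤ E (*-monoʳ-≤ (size v) (<⇒≤ q)))))) ⟩
    E * N * (μ ⊔ ℓ v) ∎
    where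
    open ≤-Reasoning
    N = items v

-- Comparison of logarithms

n<2^n : ∀ n → n < 2 ^ n
n<2^n zero    = z<s
n<2^n (suc n) = ≤-trans (+-mono-≤ (m^n>0 2 n) (n<2^n n)) (+-monoʳ-≤ (2 ^ n) (≤-reflexive (sym (+-identityʳ _))))

-- Locates M between two consecutive values of f, unless it is below f 1.

bracket : ∀ (f : ℕ → ℕ) M j → M < f (suc j) → M < f 1 ⊎ ∃[ μ ] 1 ≤ μ × f μ ≤ M × M < f (suc μ)
bracket f M zero    M< = inj₁ M<
bracket f M (suc j) M< with f (suc j) ≤? M
... | yes ≤M = inj₂ (suc j , s≤s z≤n , ≤M , M<)
... | no  ≰M = bracket f M j (≰⇒> ≰M)

-- Here x / y exceeds α by at most α l / μ, and μ is at least log_b M / ρ, so that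
-- l / μ is at most ρ log_M (b ^ l).

exponentiate : ∀ b .{{_ : NonZero b}} {x y l μ ρ α M} .{{_ : NonZero μ}} →
  x * μ ≤ α * y * (μ ⊔ l) → M ≤ b ^ (ρ * μ) →
  x ≤ (α + ρ * α) * y ·⟨1+log[ M ] b ^ l ⟩
exponentiate b {x} {y} {l} {μ} {ρ} {α} {M} x≤ M≤ = begin
  M ^ (x ∸ K * y)                ≤⟨ ^-monoˡ-≤ (x ∸ K * y) M≤ ⟩
  (b ^ (ρ * μ)) ^ (x ∸ K * y)    ≡⟨ ^-*-assoc b (ρ * μ) _ ⟩
  b ^ (ρ * μ * (x ∸ K * y))      ≤⟨ ^-monoʳ-≤ b exponent≤ ⟩
  b ^ (l * (K * y))              ≡⟨ ^-*-assoc b l _ ⟨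
  (b ^ l) ^ (K * y)              ∎
  where
  open ≤-Reasoning
  K = α + ρ * α
  excess : (x ∸ K * y) * μ ≤ α * y * l
  excess = begin
    (x ∸ K * y) * μ      ≤⟨ *-monoˡ-≤ μ (∸-monoʳ-≤ x (*-monoˡ-≤ y (m≤m+n α _))) ⟩
    (x ∸ α * y) * μ      ≡⟨ *-distribʳ-∸ μ x (α * y) ⟩
    x * μ ∸ α * y * μ    ≤⟨ m≤n+o⇒m∸n≤o (x * μ) (α * y * μ) (begin
      x * μ                    ≤⟨ x≤ ⟩
      α * y * (μ ⊔ l)          ≤⟨ *-monoʳ-≤ (α * y) (m⊔n≤m+n μ l) ⟩
      α * y * (μ + l)          ≡⟨ *-distribˡ-+ (α * y) μ l ⟩
      α * y * μ + α * y * l    ∎) ⟩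
    α * y * l            ∎
  exponent≤ : ρ * μ * (x ∸ K * y) ≤ l * (K * y)
  exponent≤ = begin
    ρ * μ * (x ∸ K * y)    ≡⟨ *-assoc ρ μ _ ⟩
    ρ * (μ * (x ∸ K * y))  ≡⟨ cong (ρ *_) (*-comm μ _) ⟩
    ρ * ((x ∸ K * y) * μ)  ≤⟨ *-monoʳ-≤ ρ excess ⟩
    ρ * (α * y * l)        ≡⟨ rearrange ρ α y l ⟩
    l * (ρ * α * y)        ≤⟨ *-monoʳ-≤ l (*-monoˡ-≤ y (m≤n+m (ρ * α) α)) ⟩
    l * (K * y)            ∎
    where
    rearrange : ∀ ρ α y l → ρ * (α * y * l) ≡ l * (ρ * α * y)
    rearrange = solve-∀

-- Choice of the constants

module _ {b : ℕ} (1<b : 1 < b) (I : Implementation b) where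

  private instance
    b≢0 : NonZero b
    b≢0 = >-nonZero (<-trans z<s 1<b)

  n≤b^n : ∀ n → n ≤ b ^ n
  n≤b^n n = ≤-trans (<⇒≤ (n<2^n n)) (^-monoˡ-≤ n 1<b)

  module _ (κ : ℕ) where

    -- E must be at least 1 + 2 H for blocks-≤, and H * H at least b * b * E * κ for
    -- width-fixContig; both hold once H is large compared with κ.

    H logE E : ℕ
    H    = b ^ (4 + κ)
    logE = 6 + κ
    E    = b ^ logE

    -- A cache with M < b ^ (4 + logE) has block size at most κ * b ^ (4 + logE), and
    -- there the length of the trace bounds the misses.  The summands of α serve the two
    -- ranges of M, and ρ is the constant of exponentiate in both.

    traceRate α ρ : ℕ
    traceRate = rate 1<b (proj₂ (length-trace-additive 1<b I))
    α         = traceRate * (κ * b ^ (4 + logE)) + E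
    ρ         = 8 + logE

    H-E : 1 + 2 * H ≤ E
    H-E = begin
      1 + 2 * H   ≤⟨ +-monoˡ-≤ (2 * H) (m^n>0 b (4 + κ)) ⟩
      H + 2 * H   ≤⟨ *-monoˡ-≤ H (n≤1+n 3) ⟩
      2 * 2 * H   ≤⟨ *-monoˡ-≤ H (*-mono-≤ 1<b 1<b) ⟩
      b * b * H   ≡⟨ *-assoc b b H ⟩
      b ^ (6 + κ) ∎
      where open ≤-Reasoning

    E-H : b * b * E * κ ≤ H * H
    E-H = begin
      b * b * E * κ         ≤⟨ *-monoʳ-≤ (b * b * E) (n≤b^n κ) ⟩
      b * b * E * b ^ κ     ≡⟨ cong (_* b ^ κ) (*-assoc b b E) ⟩
      b ^ (8 + κ) * b ^ κ   ≡⟨ ^-distribˡ-+-* b (8 + κ) κ ⟨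
      b ^ (8 + κ + κ)       ≡⟨ cong (b ^_) (double κ) ⟩
      b ^ (4 + κ + (4 + κ)) ≡⟨ ^-distribˡ-+-* b (4 + κ) (4 + κ) ⟩
      H * H                 ∎
      where
      open ≤-Reasoning
      double : ∀ κ → 8 + κ + κ ≡ 4 + κ + (4 + κ)
      double = solve-∀

    -- The factor in the bound on the cache misses.

    K : ℕ
    K = α + ρ * α

    -- In the second case μ is maximal with b ^ (4 * μ + logE) ≤ M.  A view with s < n
    -- that does not fit has M < E * n * n, which gives ℓ > 2 * μ.

    cacheMisses-≤ : ∀ M B .{{_ : NonZero B}} → B * B ≤ κ * M →
      ∀ v → Contiguous v → B ≤ width v → (ex : Exec v) →
      cacheMisses I M B ex * B ≤ K * items v ·⟨1+log[ M ] size v ⟩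
    cacheMisses-≤ M B tall v cont B≤ ex with bracket (λ j → b ^ (4 * j + logE)) M M
      (<-≤-trans (n<2^n M) (≤-trans (^-monoˡ-≤ M 1<b)
        (^-monoʳ-≤ b (≤-trans (n≤1+n M) (≤-trans (m≤n*m (suc M) 4) (m≤m+n (4 * suc M) logE))))))
    ... | inj₁ M< = exponentiate b {Q * B} {N} {ℓ v} {1} {ρ} {α} (begin
        Q * B * 1       ≡⟨ *-identityʳ (Q * B) ⟩
        Q * B           ≤⟨ *-mono-≤ Q≤ B≤B₀ ⟩
        traceRate * N * (1 ⊔ ℓ v) * B₀ ≡⟨ rearrange traceRate N (1 ⊔ ℓ v) B₀ ⟩
        traceRate * B₀ * N * (1 ⊔ ℓ v) ≤⟨ *-monoˡ-≤ (1 ⊔ ℓ v) (*-monoˡ-≤ N (m≤m+n (traceRate * B₀) E)) ⟩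
        α * N * (1 ⊔ ℓ v) ∎)
        (≤-trans (<⇒≤ M<) (^-monoʳ-≤ b (≤-trans (+-monoˡ-≤ logE (m≤m+n 4 4)) (≤-reflexive (sym (*-identityʳ ρ))))))
      where
      open ≤-Reasoning
      Q = cacheMisses I M B ex
      N = items v
      B₀ = κ * b ^ (4 + logE)
      Q≤ : Q ≤ traceRate * N * (1 ⊔ ℓ v)
      Q≤ = ≤-trans (optimalMisses-≤-length (M / B) [] (map (_/ B) (trace I ex)))
        (≤-trans (≤-reflexive (length-map (_/ B) (trace I ex)))
          (cost-≤ 1<b (proj₂ (length-trace-additive 1<b I)) v ex))
      B≤B₀ : B ≤ B₀
      B≤B₀ = ≤-trans (m≤m*n B B) (≤-trans tall (*-monoʳ-≤ κ (<⇒≤ M<)))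
      rearrange : ∀ a N m B → a * N * m * B ≡ a * B * N * m
      rearrange = solve-∀
    ... | inj₂ (μ , 1≤μ , ≤M , M<) = exponentiate b {Q * B} {N} {ℓ v} {μ} {ρ} {α} {{>-nonZero 1≤μ}} (begin
        Q * B * μ         ≡⟨ *-assoc Q B μ ⟩
        Q * (B * μ)       ≤⟨ misses-≤ 1<b I M B κ H E μ {{it}} {{m^n≢0 b (4 + κ)}} tall H-E E-H E-M deep v ex cont
                              (≤-trans B≤ (m≤n*m (width v) H {{m^n≢0 b (4 + κ)}})) _ [] ⟩
        E * N * (μ ⊔ ℓ v) ≤⟨ *-monoˡ-≤ (μ ⊔ ℓ v) (*-monoˡ-≤ N (m≤n+m E (traceRate * (κ * b ^ (4 + logE))))) ⟩
        α * N * (μ ⊔ ℓ v) ∎)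
        (≤-trans (<⇒≤ M<) (^-monoʳ-≤ b (begin
          4 * suc μ + logE          ≡⟨ cong (_+ logE) (*-suc 4 μ) ⟩
          4 + 4 * μ + logE          ≤⟨ +-mono-≤ (+-monoˡ-≤ (4 * μ) (m≤m*n 4 μ {{>-nonZero 1≤μ}})) (m≤m*n logE μ {{>-nonZero 1≤μ}}) ⟩
          4 * μ + 4 * μ + logE * μ  ≡⟨ collect μ logE ⟩
          ρ * μ                     ∎)))
      where
      open ≤-Reasoning
      Q = cacheMisses I M B ex
      N = items v
      collect : ∀ μ e → 4 * μ + 4 * μ + e * μ ≡ (8 + e) * μ
      collect = solve-∀
      E-M : E * (b * b) ≤ M
      E-M = begin
        E * (b * b)  ≡⟨ *-comm E _ ⟩
        b * b * E    ≡⟨ *-assoc b b E ⟩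
        b ^ (2 + logE)  ≤⟨ ^-monoʳ-≤ b (+-monoˡ-≤ logE (≤-trans (s≤s (s≤s z≤n)) (m≤m*n 4 μ {{>-nonZero 1≤μ}}))) ⟩
        b ^ (4 * μ + logE) ≤⟨ ≤M ⟩
        M ∎
      deep : ∀ l → M < E * (b ^ l * b ^ l) → μ ≤ ⌊ l /2⌋
      deep l M<E = half (*-cancelˡ-< 2 (2 * μ) l (+-cancelˡ-< logE _ _ (≰⇒> λ e+2l≤ →
        <⇒≱ M<E (begin
          E * (b ^ l * b ^ l)  ≡⟨ cong (E *_) (^-distribˡ-+-* b l l) ⟨
          E * b ^ (l + l)      ≡⟨ ^-distribˡ-+-* b logE (l + l) ⟨
          b ^ (logE + (l + l))    ≤⟨ ^-monoʳ-≤ b (begin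
            logE + (l + l)         ≡⟨ cong (λ n → logE + (l + n)) (+-identityʳ l) ⟨
            logE + 2 * l           ≤⟨ e+2l≤ ⟩
            logE + 2 * (2 * μ)     ≡⟨ cong (logE +_) (*-assoc 2 2 μ) ⟨
            logE + 4 * μ           ≡⟨ +-comm logE _ ⟩
            4 * μ + logE           ∎) ⟩
          b ^ (4 * μ + logE)      ≤⟨ ≤M ⟩
          M                    ∎))))
        where
        half : ∀ {l} → 2 * μ < l → μ ≤ ⌊ l /2⌋
        half {l} 2μ<l = subst (_≤ ⌊ l /2⌋) (trans (cong ⌊_/2⌋ (cong (μ +_) (+-identityʳ μ))) (sym (n≡⌊n+n/2⌋ μ))) (⌊n/2⌋-mono (<⇒≤ 2μ<l))

⌊log₂⌋-power : ∀ t k → ⌊log₂ (2 ^ t) ^ k ⌋ ≡ t * k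
⌊log₂⌋-power t k = trans (cong ⌊log₂_⌋ (^-*-assoc 2 t k)) (⌊log₂[2^n]⌋≡n (t * k))

proposition1 : ∀ (t : ℕ) → 1 ≤ t → (I : Implementation (2 ^ t)) →
    (∃[ K ] ∀ {L} (v : View (2 ^ t)) → IsView L v → (e : Exec v) →
    work I e ≤ K * (size v * batch v * (1 + ⌊log₂ size v ⌋)))
    × (∃[ K ] ∀ {L} (v : View (2 ^ t)) → IsView L v → (e : Exec v) →
    stackWords I e ≤ K * (1 ⊔ ⌊log₂ size v * batch v ⌋))
    × (∀ (κ : ℕ) → ∃[ K ] ∀ (M B : ℕ) .{{_ : NonZero B}} → 2 ≤ M → B * B ≤ κ * M →
    ∀ {L} (v : View (2 ^ t)) → IsView L v → B ≤ width v → (e : Exec v) →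
    cacheMisses I M B e * B ≤ K * (size v * batch v) ·⟨1+log[ M ] size v ⟩)
proposition1 t 1≤t I =
    (rate 1<b W , λ v _ e → ≤-trans (cost-≤ 1<b W v e) (work-form v))
  , (frameWords * 3 , λ v _ e → ≤-trans (stackWords-≤ 1<b I e) (stack-form v))
  , λ κ → K 1<b I κ , λ M B _ tall v isView B≤ e →
      cacheMisses-≤ 1<b I κ M B tall v (IsView.contiguous isView) B≤ e
  where
  open Implementation I
  open ≤-Reasoning
  1<b : 1 < 2 ^ t
  1<b = ^-monoʳ-≤ 2 1≤t
  W = proj₂ (work-additive 1<b I)
  k≤log : ∀ k → k ≤ ⌊log₂ (2 ^ t) ^ k ⌋
  k≤log k = subst (k ≤_) (sym (⌊log₂⌋-power t k)) (m≤n*m k t {{>-nonZero 1≤t}})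
  work-form : ∀ v → rate 1<b W * items v * (1 ⊔ ℓ v) ≤ rate 1<b W * (items v * (1 + ⌊log₂ size v ⌋))
  work-form v = begin
    rate 1<b W * items v * (1 ⊔ ℓ v)
      ≤⟨ *-monoʳ-≤ (rate 1<b W * items v) (≤-trans (m⊔n≤m+n 1 (ℓ v)) (s≤s (k≤log (ℓ v)))) ⟩
    rate 1<b W * items v * (1 + ⌊log₂ size v ⌋)  ≡⟨ *-assoc (rate 1<b W) (items v) _ ⟩
    rate 1<b W * (items v * (1 + ⌊log₂ size v ⌋)) ∎
  stack-form : ∀ v → frameWords * suc (ℓ v + digits v) ≤ frameWords * 3 * (1 ⊔ ⌊log₂ items v ⌋)
  stack-form v = begin
    frameWords * suc (ℓ v + digits v)
      ≤⟨ *-monoʳ-≤ frameWords (+-mono-≤ (m≤m⊔n 1 D)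
           (+-mono-≤ (≤-trans (m≤m+n (ℓ v) _) (≤-trans D≤ (m≤n⊔m 1 D))) (≤-trans (≤-trans D≤ (m≤n⊔m 1 D)) (≤-reflexive (sym (+-identityʳ _)))))) ⟩
    frameWords * (3 * (1 ⊔ D)) ≡⟨ *-assoc frameWords 3 _ ⟨
    frameWords * 3 * (1 ⊔ D) ∎
    where
    D = ⌊log₂ items v ⌋
    D≤ : digits v ≤ D
    D≤ = subst (digits v ≤_) (cong ⌊log₂_⌋ (sym (items≡b^digits v))) (k≤log (digits v))
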